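{- There exist a finite simple acyclic directed graph $G=(V,E)$ and vertices $u,v\in V$ such that, in $\tfrac12$-Bernoulli bond percolation on the bunkbed graph $\overline{G}$ of $G$, $$\mathbb{P}_{1/2}(u^-\to v^-)<\mathbb{P}_{1/2}(u^-\to v^+).$$
   Context: A directed graph is simple if it has no loops and no multiple edges, and acyclic if it contains no directed cycle. Bunkbed graph: for a directed graph $G=(V,E)$, let $(V^-,E^-)$ and $(V^+,E^+)$ be two disjoint copies of $G$, where $v^-$ and $v^+$ denote the copies of $v\in V$ in $V^-$ and $V^+$. The bunkbed graph $\overline{G}=(\overline{V},\overline{E})$ has $\overline{V}=V^-\sqcup V^+$ and $\overline{E}=E^-\sqcup E^+\sqcup\widetilde{E}$, where $\widetilde{E}$ consists of one bidirected (vertical) edge $(v^-,v^+)$ for each $v\in V$. Each horizontal edge (an element of $E^-\sqcup E^+$) keeps the direction it has in $G$; each vertical edge is a single edge that can be traversed in both directions. Percolation: $\mathbb{P}_{p}$ is the law of the random spanning subgraph of $\overline{G}$ in which every edge of $\overline{E}$ is retained with probability $p$ and deleted with probability $1-p$, independently of all other edges (each bidirected vertical edge is retained or deleted as one edge). For $x,y\in\overline{V}$, the event $x\to y$ is that the percolated subgraph contains a directed path from $x$ to $y$, where retained vertical edges may be used in either direction. -}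

module Defs where

open import Data.Nat.Base using (ℕ; zero; suc)
import Data.Nat.Base as ℕ
open import Data.Fin.Base using (Fin; _↑ˡ_; _↑ʳ_)
open import Data.Fin.Properties using (any?)
import Data.Fin.Properties as Fin
open import Data.Fin.Subset using (Subset; inside; outside; _∈_)
open import Data.Fin.Subset.Properties using (_∈?_)
open import Data.List.Base as List using (List; filter; foldr; allFin)
open import Data.List.Membership.Propositional using () renaming (_∈_ to _∈ˡ_)
open import Data.List.Membership.Propositional.Properties
  using (∈-map⁺; ∈-++⁺ˡ; ∈-++⁺ʳ; ∈-allFin)
open import Data.List.Relation.Unary.Any using (here; there)
open import Data.Product using (_×_; _,_)
open import Data.Rational using (ℚ; 0ℚ; 1ℚ; _+_; _*_; _-_)
open import Data.Sum using (_⊎_; inj₁; inj₂)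
open import Data.Vec.Base as Vec using ()
open import Relation.Binary.Construct.Closure.ReflexiveTransitive
  using (Star; ε; _◅_; _◅◅_)
open import Relation.Binary.Construct.Closure.Transitive using (TransClosure)
open import Relation.Binary.Core using (Rel)
open import Relation.Binary.Definitions using (DecidableEquality) renaming (Decidable to Decidable₂)
open import Relation.Binary.PropositionalEquality using (_≡_; _≢_; refl)
open import Relation.Nullary using (¬_; no)
open import Relation.Nullary.Decidable using (map′; _×-dec_; _⊎-dec_)
open import Level using (0ℓ)
open import Relation.Unary using (Pred; Decidable)

------------------------------------------------------------------------
-- Finite directed graphs

-- Loops and multiple edges are allowed here; Simple excludes them.

record Digraph : Set where
  field
    #V  : ℕ
    #E  : ℕ
    src : Fin #E → Fin #V
    tgt : Fin #E → Fin #V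

  V : Set
  V = Fin #V

  E : Set
  E = Fin #E

open Digraph public using (V; E)

module _ (G : Digraph) where
  open Digraph G using (src; tgt)

  data Adjacent : V G → V G → Set where
    edge : (e : E G) → Adjacent (src e) (tgt e)

  record Simple : Set where
    field
      noLoops         : ∀ e → src e ≢ tgt e
      noMultipleEdges : ∀ e f → src e ≡ src f → tgt e ≡ tgt f → e ≡ f

  -- A nonempty closed directed walk exists exactly when a directed
  -- cycle does.

  Acyclic : Set
  Acyclic = ∀ v → ¬ TransClosure Adjacent v v

------------------------------------------------------------------------
-- Bernoulli measure on the subsets of a k-element set

subsets : ∀ k → List (Subset k)
subsets zero    = Vec.[] List.∷ List.[]
subsets (suc k) = List.map (inside  Vec.∷_) (subsets k) List.++
                  List.map (outside Vec.∷_) (subsets k)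

weight : ∀ {k} → ℚ → Subset k → ℚ
weight p Vec.[]              = 1ℚ
weight p (inside  Vec.∷ ω) = p * weight p ω
weight p (outside Vec.∷ ω) = (1ℚ - p) * weight p ω

sum : List ℚ → ℚ
sum = foldr _+_ 0ℚ

ℙ : ∀ {k ℓ} (p : ℚ) {A : Pred (Subset k) ℓ} → Decidable A → ℚ
ℙ {k} p A? = sum (List.map (weight p) (filter A? (subsets k)))

------------------------------------------------------------------------
-- Reachability over a finite set is decidable (Warshall's algorithm)

-- Via R zs x y: x = y, or there is a walk from x to y all of whose
-- intermediate vertices lie in zs.

Via : ∀ {a} {X : Set a} → Rel X a → List X → Rel X a
Via R List.[]       x y = x ≡ y ⊎ R x y
Via R (z List.∷ zs) x y = Via R zs x y ⊎ (Via R zs x z × Via R zs z y)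

module _ {a} {X : Set a} {R : Rel X a} where

  via? : DecidableEquality X → Decidable₂ R → ∀ zs → Decidable₂ (Via R zs)
  via? _≟_ R? List.[]       x y = (x ≟ y) ⊎-dec R? x y
  via? _≟_ R? (z List.∷ zs) x y =
    via? _≟_ R? zs x y ⊎-dec (via? _≟_ R? zs x z ×-dec via? _≟_ R? zs z y)

  via⇒star : ∀ zs {x y} → Via R zs x y → Star R x y
  via⇒star List.[]       (inj₁ refl)    = ε
  via⇒star List.[]       (inj₂ xRy)     = xRy ◅ ε
  via⇒star (z List.∷ zs) (inj₁ v)       = via⇒star zs v
  via⇒star (z List.∷ zs) (inj₂ (v , w)) = via⇒star zs v ◅◅ via⇒star zs w

  base : ∀ zs {x y} → x ≡ y ⊎ R x y → Via R zs x y
  base List.[]       v = v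
  base (z List.∷ zs) v = inj₁ (base zs v)

  comp : ∀ zs {x y z} → z ∈ˡ zs → Via R zs x z → Via R zs z y → Via R zs x y
  comp (_ List.∷ zs) (here refl) v w = inj₂ (toHead v , fromHead w)
    where
    toHead : ∀ {x z} → Via R (z List.∷ zs) x z → Via R zs x z
    toHead (inj₁ v)       = v
    toHead (inj₂ (v , _)) = v
    fromHead : ∀ {y z} → Via R (z List.∷ zs) z y → Via R zs z y
    fromHead (inj₁ w)       = w
    fromHead (inj₂ (_ , w)) = w
  comp (_ List.∷ zs) (there i) (inj₁ v)       (inj₁ w)       = inj₁ (comp zs i v w)
  comp (_ List.∷ zs) (there i) (inj₁ v)       (inj₂ (w , t)) = inj₂ (comp zs i v w , t)
  comp (_ List.∷ zs) (there i) (inj₂ (s , v)) (inj₁ w)       = inj₂ (s , comp zs i v w)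
  comp (_ List.∷ zs) (there i) (inj₂ (s , _)) (inj₂ (_ , t)) = inj₂ (s , t)

  star⇒via : ∀ zs → (∀ x → x ∈ˡ zs) → ∀ {x y} → Star R x y → Via R zs x y
  star⇒via zs all ε          = base zs (inj₁ refl)
  star⇒via zs all (xRz ◅ rs) = comp zs (all _) (base zs (inj₂ xRz)) (star⇒via zs all rs)

star? : ∀ {a} {X : Set a} {R : Rel X a} → DecidableEquality X → Decidable₂ R →
        (xs : List X) → (∀ x → x ∈ˡ xs) → Decidable₂ (Star R)
star? _≟_ R? xs all x y =
  map′ (via⇒star xs) (star⇒via xs all) (via? _≟_ R? xs x y)

------------------------------------------------------------------------
-- Bunkbed graphs

module Bunkbed (G : Digraph) where
  open Digraph G using (#V; #E; src; tgt)

  infix 8 _⁻ _⁺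

  data V̄ : Set where
    _⁻ _⁺ : V G → V̄

  -- The edge set of the bunkbed graph is E⁻ ⊔ E⁺ ⊔ Ẽ, numbered in
  -- that order.

  #Ē : ℕ
  #Ē = #E ℕ.+ (#E ℕ.+ #V)

  lower upper : E G → Fin #Ē
  lower e = e ↑ˡ (#E ℕ.+ #V)
  upper e = #E ↑ʳ (e ↑ˡ #V)

  vertical : V G → Fin #Ē
  vertical v = #E ↑ʳ (#E ↑ʳ v)

  -- ω is the set of retained edges.  A single element of Ē, vertical v,
  -- governs both directions of the vertical edge at v.

  data Step (ω : Subset #Ē) : V̄ → V̄ → Set where
    along⁻ : ∀ e → lower e ∈ ω    → Step ω (src e ⁻) (tgt e ⁻)
    along⁺ : ∀ e → upper e ∈ ω    → Step ω (src e ⁺) (tgt e ⁺)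
    up     : ∀ v → vertical v ∈ ω → Step ω (v ⁻) (v ⁺)
    down   : ∀ v → vertical v ∈ ω → Step ω (v ⁺) (v ⁻)

  infix 4 _⟶_ _⟶?_

  _⟶_ : V̄ → V̄ → Pred (Subset #Ē) 0ℓ
  (x ⟶ y) ω = Star (Step ω) x y

  _≟_ : DecidableEquality V̄
  (u ⁻) ≟ (v ⁻) = map′ (λ { refl → refl }) (λ { refl → refl }) (u Fin.≟ v)
  (u ⁻) ≟ (v ⁺) = no λ ()
  (u ⁺) ≟ (v ⁻) = no λ ()
  (u ⁺) ≟ (v ⁺) = map′ (λ { refl → refl }) (λ { refl → refl }) (u Fin.≟ v)

  step? : ∀ ω → Decidable₂ (Step ω)
  step? ω (u ⁻) (v ⁻) =
    map′ (λ { (e , refl , refl , i) → along⁻ e i }) (λ { (along⁻ e i) → e , refl , refl , i })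
      (any? λ e → (src e Fin.≟ u) ×-dec ((tgt e Fin.≟ v) ×-dec (lower e ∈? ω)))
  step? ω (u ⁺) (v ⁺) =
    map′ (λ { (e , refl , refl , i) → along⁺ e i }) (λ { (along⁺ e i) → e , refl , refl , i })
      (any? λ e → (src e Fin.≟ u) ×-dec ((tgt e Fin.≟ v) ×-dec (upper e ∈? ω)))
  step? ω (u ⁻) (v ⁺) =
    map′ (λ { (refl , i) → up _ i }) (λ { (up _ i) → refl , i })
      ((u Fin.≟ v) ×-dec (vertical u ∈? ω))
  step? ω (u ⁺) (v ⁻) =
    map′ (λ { (refl , i) → down _ i }) (λ { (down _ i) → refl , i })
      ((u Fin.≟ v) ×-dec (vertical u ∈? ω))

  vertices : List V̄
  vertices = List.map _⁻ (allFin #V) List.++ List.map _⁺ (allFin #V)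

  ∈-vertices : ∀ x → x ∈ˡ vertices
  ∈-vertices (v ⁻) = ∈-++⁺ˡ (∈-map⁺ _⁻ (∈-allFin v))
  ∈-vertices (v ⁺) = ∈-++⁺ʳ (List.map _⁻ (allFin #V)) (∈-map⁺ _⁺ (∈-allFin v))

  _⟶?_ : ∀ x y → Decidable (x ⟶ y)
  (x ⟶? y) ω = star? _≟_ (step? ω) vertices ∈-vertices x y

{-# OPTIONS --safe #-}

-- Let G be the path 0 → 1 → ⋯ → 39 with the chords 0 → 11, 10 → 30 and
-- 29 → 39, and let u = 0, v = 39.  Only outcomes that are not symmetric under
-- exchanging the levels matter, and on these the long segments 1 → ⋯ → 9,
-- 12 → ⋯ → 28 and 31 → ⋯ → 38 act, up to a small error, as vertices whose
-- vertical edge is retained: long survival on a single level is much rarer.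
--
-- So suppose that 10 is reached on a single level, and let σ = 1 for − and
-- σ = −1 for +.  As 10 is entered through such a segment, E[σ] is almost 0.
-- Vertex 11 is entered from 0 on level − and from 10 on the level of 10.  If
-- the latter is +, these chances are spread over both levels and the middle
-- segment is more likely to be reached.  Hence a = E[σ ; segment reached] < 0.
-- Reversing all edges exchanges 10 and 30, and gives σ′ and a′ in the same way.
-- If the middle segment is reached from both sides, then v is reached on both
-- levels; otherwise v is reached through 10 → 30, on the level σσ′.  Therefore
-- the difference of the two probabilities is, up to a positive factor,
-- E[σ] E[σ′] − a a′ < 0.
--
-- The segments are long enough for the errors not to spoil this, as an exact
-- computation shows.  Along the path, the levels on which the current vertex
-- and the latest vertex among 0, 10, 29 with a pending chord (the hub) are
-- reached form a Markov chain with 16 states.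

module Submission where

open import Defs
open import Data.Bool.Base using (Bool; true; false; not; _∧_; _∨_; if_then_else_)
open import Data.Bool.Properties using (∧-identityʳ)
open import Data.Empty using (⊥)
open import Data.Fin using (Fin; zero; suc; toℕ; inject₁; fromℕ; #_)
import Data.Fin.Base as Fin
open import Data.Fin.Patterns using (0F; 1F; 2F)
import Data.Fin.Properties as Fin
open import Data.Fin.Subset using (Subset; _∈_)
open import Data.Fin.Subset.Properties using (_∈?_)
open import Data.List.Base as List using (List; []; _∷_; _++_; concat; filter; length; map)
open import Data.List.Properties using (filter-++; length-++)
open import Data.List.Relation.Unary.All using (All; []; _∷_)
open import Data.List.Relation.Unary.AllPairs using ([]; _∷_)
open import Data.List.Relation.Unary.Unique.Propositional using (Unique)
import Data.List.Relation.Unary.Unique.DecPropositional as DecUnique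
open import Data.Maybe.Base using (Maybe; just; nothing)
open import Data.Nat.Base as ℕ using (ℕ; _≤ᵇ_; _≡ᵇ_; _^_)
import Data.Nat.Properties as ℕ
open import Data.Product using (Σ-syntax; ∃; _×_; _,_; proj₁)
open import Data.Rational using (ℚ; ½; _<_; _≤_; 0ℚ; 1ℚ; _+_; _*_; Positive)
import Data.Rational.Properties as ℚ
open import Data.Sum using (_⊎_; inj₁; inj₂)
open import Data.Unit.Base using (⊤; tt)
open import Data.Vec.Base using (Vec; []; _∷_; lookup; _[_]≔_)
open import Data.Vec.Properties using (lookup∘update; lookup∘update′)
open import Function.Base using (_∘_; _$_)
open import Function.Bundles using (_⇔_; mk⇔; Equivalence)
open import Relation.Binary.Construct.Closure.ReflexiveTransitive using (Star; ε; _◅_; _◅◅_)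
open import Relation.Binary.Construct.Closure.Transitive using (TransClosure; [_]; _∷_)
open import Relation.Binary.PropositionalEquality
open import Relation.Nullary using (Dec; does; yes; no)
open import Relation.Nullary.Decidable
  using (from-yes; does-⇔; does-≡; _×-dec_; _⊎-dec_; _→-dec_)
open import Relation.Unary using (Pred; Decidable)
open import Algebra.Properties.CommutativeSemigroup ℕ.+-commutativeSemigroup using (interchange)
open import Algebra.Properties.Monoid.Mult ℚ.+-0-monoid using () renaming (_×_ to _·_)

private
  variable
    k n : ℕ

-- Counting subsets

𝟙 : Bool → ℕ
𝟙 b = if b then 1 else 0

tally : (Subset k → ℕ) → ℕ
tally {ℕ.zero}  f = f []
tally {ℕ.suc k} f = tally (f ∘ (true ∷_)) ℕ.+ tally (f ∘ (false ∷_))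

tally-cong : {f g : Subset k → ℕ} → f ≗ g → tally f ≡ tally g
tally-cong {ℕ.zero}  f≗g = f≗g []
tally-cong {ℕ.suc k} f≗g =
  cong₂ ℕ._+_ (tally-cong (f≗g ∘ (true ∷_))) (tally-cong (f≗g ∘ (false ∷_)))

tally-const : ∀ c → tally {k} (λ _ → c) ≡ 2 ^ k ℕ.* c
tally-const {ℕ.zero}  c = sym (ℕ.*-identityˡ c)
tally-const {ℕ.suc k} c = begin
  tally {k} (λ _ → c) ℕ.+ tally {k} (λ _ → c)  ≡⟨ cong₂ ℕ._+_ (tally-const {k} c) (tally-const {k} c) ⟩
  2 ^ k ℕ.* c ℕ.+ 2 ^ k ℕ.* c                  ≡⟨ ℕ.*-distribʳ-+ c (2 ^ k) (2 ^ k) ⟨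
  (2 ^ k ℕ.+ 2 ^ k) ℕ.* c                      ≡⟨ cong (λ x → (2 ^ k ℕ.+ x) ℕ.* c) (ℕ.+-identityʳ (2 ^ k)) ⟨
  2 ^ ℕ.suc k ℕ.* c                            ∎
  where open ≡-Reasoning

-- Overwriting bit `i` by both values hits every subset exactly twice. This allows a count to be
-- split on any coordinate, so that edges can be revealed in scan order instead of index order.
tally-update : ∀ (i : Fin k) f →
  tally (f ∘ (_[ i ]≔ true)) ℕ.+ tally (f ∘ (_[ i ]≔ false)) ≡ tally f ℕ.+ tally f
tally-update zero f =
  interchange (tally (f ∘ (true ∷_))) _ _ (tally (f ∘ (false ∷_)))
tally-update (suc i) f = begin
  (t true true ℕ.+ t false true) ℕ.+ (t true false ℕ.+ t false false)
    ≡⟨ interchange (t true true) _ _ _ ⟩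
  (t true true ℕ.+ t true false) ℕ.+ (t false true ℕ.+ t false false)
    ≡⟨ cong₂ ℕ._+_ (tally-update i (f ∘ (true ∷_))) (tally-update i (f ∘ (false ∷_))) ⟩
  (tally (f ∘ (true ∷_)) ℕ.+ tally (f ∘ (true ∷_))) ℕ.+ (tally (f ∘ (false ∷_)) ℕ.+ tally (f ∘ (false ∷_)))
    ≡⟨ interchange (tally (f ∘ (true ∷_))) _ _ _ ⟩
  tally f ℕ.+ tally f ∎
  where
  open ≡-Reasoning
  t : Bool → Bool → ℕ
  t x b = tally (λ ω → f (x ∷ (ω [ i ]≔ b)))

length-filter-map : ∀ {a p} {A B : Set a} {P : Pred B p} (P? : Decidable P) (f : A → B) xs →
  length (filter P? (map f xs)) ≡ length (filter (P? ∘ f) xs)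
length-filter-map P? f []       = refl
length-filter-map P? f (x ∷ xs) with does (P? (f x))
... | true  = cong ℕ.suc (length-filter-map P? f xs)
... | false = length-filter-map P? f xs

length-filter-subsets : ∀ {ℓ} {A : Pred (Subset k) ℓ} (A? : Decidable A) →
  length (filter A? (subsets k)) ≡ tally (λ ω → 𝟙 (does (A? ω)))
length-filter-subsets {ℕ.zero} A? with does (A? [])
... | true  = refl
... | false = refl
length-filter-subsets {ℕ.suc k} A? = begin
  length (filter A? (xs ++ ys))                    ≡⟨ cong length (filter-++ A? xs ys) ⟩
  length (filter A? xs ++ filter A? ys)            ≡⟨ length-++ (filter A? xs) ⟩
  length (filter A? xs) ℕ.+ length (filter A? ys)  ≡⟨ cong₂ ℕ._+_ (half true) (half false) ⟩
  tally (λ ω → 𝟙 (does (A? ω)))                    ∎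
  where
  open ≡-Reasoning
  xs = map (true ∷_) (subsets k)
  ys = map (false ∷_) (subsets k)
  half : ∀ b → length (filter A? (map (b ∷_) (subsets k))) ≡ tally (λ ω → 𝟙 (does (A? (b ∷ ω))))
  half b = trans (length-filter-map A? (b ∷_) (subsets k)) (length-filter-subsets (A? ∘ (b ∷_)))

-- Probability at 1/2 as a count of equally weighted outcomes

½^ : ℕ → ℚ
½^ ℕ.zero    = 1ℚ
½^ (ℕ.suc k) = ½ * ½^ k

½^-positive : ∀ k → Positive (½^ k)
½^-positive ℕ.zero    = _
½^-positive (ℕ.suc k) = ℚ.pos*pos⇒pos ½ (½^ k) {{½^-positive k}}

weight-½ : (ω : Subset k) → weight ½ ω ≡ ½^ k
weight-½ []          = refl
weight-½ (true  ∷ ω) = cong (½ *_) (weight-½ ω)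
weight-½ (false ∷ ω) = cong (½ *_) (weight-½ ω)

sum-weight-½ : (ωs : List (Subset k)) → sum (map (weight ½) ωs) ≡ length ωs · ½^ k
sum-weight-½ []       = refl
sum-weight-½ (ω ∷ ωs) = cong₂ _+_ (weight-½ ω) (sum-weight-½ ωs)

·-nonNegative : ∀ q {{_ : Positive q}} n → 0ℚ ≤ n · q
·-nonNegative q ℕ.zero    = ℚ.≤-refl
·-nonNegative q (ℕ.suc n) = ℚ.+-mono-≤ (ℚ.<⇒≤ (ℚ.positive⁻¹ q)) (·-nonNegative q n)

·-monoˡ-< : ∀ q {{_ : Positive q}} {m n} → m ℕ.< n → m · q < n · q
·-monoˡ-< q {ℕ.zero}  {ℕ.suc n} _           = ℚ.+-mono-<-≤ (ℚ.positive⁻¹ q) (·-nonNegative q n)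
·-monoˡ-< q {ℕ.suc m} {ℕ.suc n} (ℕ.s≤s m<n) = ℚ.+-monoʳ-< q (·-monoˡ-< q m<n)

ℙ-½-mono-< : ∀ {a b} {A : Pred (Subset k) a} {B : Pred (Subset k) b}
  (A? : Decidable A) (B? : Decidable B) →
  tally (λ ω → 𝟙 (does (A? ω))) ℕ.< tally (λ ω → 𝟙 (does (B? ω))) → ℙ ½ A? < ℙ ½ B?
ℙ-½-mono-< {k} A? B? A<B = subst₂ _<_ (sym (ℙ≡ A?)) (sym (ℙ≡ B?)) (·-monoˡ-< (½^ k) {{½^-positive k}} A<B)
  where
  ℙ≡ : ∀ {c} {C : Pred (Subset k) c} (C? : Decidable C) → ℙ ½ C? ≡ tally (λ ω → 𝟙 (does (C? ω))) · ½^ k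
  ℙ≡ C? = trans (sum-weight-½ (filter C? (subsets k))) (cong (_· ½^ k) (length-filter-subsets C?))

-- Finite-state scans of the coordinates of a subset

Scan : ℕ → ℕ → Set
Scan k n = List (Fin k × (Bool → Vec Bool n → Vec Bool n))

run : Scan k n → Subset k → Vec Bool n → Vec Bool n
run []            ω s = s
run ((i , f) ∷ p) ω s = run p ω (f (does (i ∈? ω)) s)

run-++ : ∀ (p q : Scan k n) ω s → run (p ++ q) ω s ≡ run q ω (run p ω s)
run-++ []            q ω s = refl
run-++ ((i , f) ∷ p) q ω s = run-++ p q ω (f (does (i ∈? ω)) s)

does-∈? : ∀ (i : Fin k) ω → does (i ∈? ω) ≡ lookup ω i
does-∈? zero    (true  ∷ ω) = refl
does-∈? zero    (false ∷ ω) = refl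
does-∈? (suc i) (x     ∷ ω) = does-∈? i ω

does-∈?-update : ∀ (i : Fin k) ω b → does (i ∈? (ω [ i ]≔ b)) ≡ b
does-∈?-update i ω b = trans (does-∈? i _) (lookup∘update i ω b)

does-∈?-update′ : ∀ {i j : Fin k} → i ≢ j → ∀ ω b → does (j ∈? (ω [ i ]≔ b)) ≡ does (j ∈? ω)
does-∈?-update′ {i = i} {j} i≢j ω b = begin
  does (j ∈? (ω [ i ]≔ b))  ≡⟨ does-∈? j _ ⟩
  lookup (ω [ i ]≔ b) j     ≡⟨ lookup∘update′ (i≢j ∘ sym) ω b ⟩
  lookup ω j                ≡⟨ does-∈? j ω ⟨
  does (j ∈? ω)             ∎
  where open ≡-Reasoning

run-update : ∀ {i} (p : Scan k n) → All (i ≢_) (map proj₁ p) → ∀ ω b s →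
  run p (ω [ i ]≔ b) s ≡ run p ω s
run-update []            []            ω b s = refl
run-update ((j , f) ∷ p) (i≢j ∷ fresh) ω b s =
  trans (run-update p fresh ω b _) (cong (λ x → run p ω (f x s)) (does-∈?-update′ i≢j ω b))

-- A function on states, stored as a tree so that its values are shared when
-- the type checker evaluates table.

Table : ℕ → Set
Table ℕ.zero    = ℕ
Table (ℕ.suc n) = Table n × Table n

tabulate : (Vec Bool n → ℕ) → Table n
tabulate {ℕ.zero}  f = f []
tabulate {ℕ.suc n} f = tabulate (f ∘ (true ∷_)) , tabulate (f ∘ (false ∷_))

read : Table n → Vec Bool n → ℕ
read t         []          = t
read (t₁ , t₀) (true  ∷ s) = read t₁ s
read (t₁ , t₀) (false ∷ s) = read t₀ s

read-tabulate : ∀ (f : Vec Bool n → ℕ) s → read (tabulate f) s ≡ f s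
read-tabulate f []          = refl
read-tabulate f (true  ∷ s) = read-tabulate (f ∘ (true ∷_)) s
read-tabulate f (false ∷ s) = read-tabulate (f ∘ (false ∷_)) s

pull : (Bool → Vec Bool n → Vec Bool n) → Table n → Table n
pull f t = tabulate (λ s → read t (f true s) ℕ.+ read t (f false s))

table : Scan k n → (Vec Bool n → ℕ) → Table n
table []            φ = tabulate φ
table ((i , f) ∷ p) φ = pull f (table p φ)

-- Backward dynamic programming: `table` sums `φ` over the values of the scanned bits only, each
-- choice of which extends to `2 ^ (k - length p)` subsets; cross-multiplying avoids the
-- subtraction. By uniqueness, forcing the first bit leaves all later reads unchanged.
tally-run : ∀ (p : Scan k n) → Unique (map proj₁ p) → ∀ φ s →
  tally (λ ω → φ (run p ω s)) ℕ.* 2 ^ length p ≡ 2 ^ k ℕ.* read (table p φ) s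
tally-run {k} [] [] φ s = begin
  tally {k} (λ _ → φ s) ℕ.* 1      ≡⟨ ℕ.*-identityʳ _ ⟩
  tally {k} (λ _ → φ s)            ≡⟨ tally-const {k} (φ s) ⟩
  2 ^ k ℕ.* φ s                    ≡⟨ cong (2 ^ k ℕ.*_) (read-tabulate φ s) ⟨
  2 ^ k ℕ.* read (tabulate φ) s    ∎
  where open ≡-Reasoning
tally-run {k} ((i , f) ∷ p) (fresh ∷ unique) φ s = begin
  T ℕ.* (2 ℕ.* P)                            ≡⟨ ℕ.*-assoc T 2 P ⟨
  T ℕ.* 2 ℕ.* P                              ≡⟨ cong (ℕ._* P) (trans (ℕ.*-comm T 2) (cong (T ℕ.+_) (ℕ.+-identityʳ T))) ⟩
  (T ℕ.+ T) ℕ.* P                            ≡⟨ cong (ℕ._* P) (tally-update i _) ⟨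
  (tally (λ ω → φ (step (ω [ i ]≔ true))) ℕ.+ tally (λ ω → φ (step (ω [ i ]≔ false)))) ℕ.* P
                                             ≡⟨ cong (ℕ._* P) (cong₂ ℕ._+_ (tally-cong (fix true)) (tally-cong (fix false))) ⟩
  (T′ true ℕ.+ T′ false) ℕ.* P               ≡⟨ ℕ.*-distribʳ-+ P (T′ true) (T′ false) ⟩
  T′ true ℕ.* P ℕ.+ T′ false ℕ.* P           ≡⟨ cong₂ ℕ._+_ (tally-run p unique φ (f true s)) (tally-run p unique φ (f false s)) ⟩
  2 ^ k ℕ.* r true ℕ.+ 2 ^ k ℕ.* r false     ≡⟨ ℕ.*-distribˡ-+ (2 ^ k) (r true) (r false) ⟨
  2 ^ k ℕ.* (r true ℕ.+ r false)             ≡⟨ cong (2 ^ k ℕ.*_) (read-tabulate _ s) ⟨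
  2 ^ k ℕ.* read (table ((i , f) ∷ p) φ) s   ∎
  where
  open ≡-Reasoning
  P = 2 ^ length p
  step : Subset k → Vec Bool _
  step ω = run ((i , f) ∷ p) ω s
  T = tally (λ ω → φ (step ω))
  T′ r : Bool → ℕ
  T′ b = tally (λ ω → φ (run p ω (f b s)))
  r b = read (table p φ) (f b s)
  fix : ∀ b ω → φ (step (ω [ i ]≔ b)) ≡ φ (run p ω (f b s))
  fix b ω = cong φ (trans (run-update p fresh ω b _)
                          (cong (λ x → run p ω (f x s)) (does-∈?-update i ω b)))

ℙ-½-scan-< : ∀ {a b} {A : Pred (Subset k) a} {B : Pred (Subset k) b}
  (A? : Decidable A) (B? : Decidable B) (p : Scan k n) → Unique (map proj₁ p) → ∀ φ ψ s →
  (∀ ω → φ (run p ω s) ≡ 𝟙 (does (A? ω))) → (∀ ω → ψ (run p ω s) ≡ 𝟙 (does (B? ω))) →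
  read (table p φ) s ℕ.< read (table p ψ) s → ℙ ½ A? < ℙ ½ B?
ℙ-½-scan-< {k} A? B? p unique φ ψ s φ≡A ψ≡B φ<ψ =
  ℙ-½-mono-< A? B? $ subst₂ ℕ._<_ (tally-cong φ≡A) (tally-cong ψ≡B) $
  ℕ.*-cancelʳ-< (2 ^ length p) _ _ $
  subst₂ ℕ._<_ (sym (tally-run p unique φ s)) (sym (tally-run p unique ψ s)) $
  ℕ.*-monoʳ-< (2 ^ k) {{ℕ.m^n≢0 2 k}} φ<ψ

-- `σ i` is the invariant state before block `i`. The scan enters only through an equation, so it
-- may be opaque.
run-concat : ∀ {m} {p : Scan k n} (f : Fin m → Scan k n) → p ≡ concat (List.tabulate f) →
  ∀ ω (σ : Fin (ℕ.suc m) → Vec Bool n) → (∀ i → run (f i) ω (σ (inject₁ i)) ≡ σ (suc i)) →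
  run p ω (σ zero) ≡ σ (fromℕ m)
run-concat {m = ℕ.zero}  f refl ω σ inv = refl
run-concat {m = ℕ.suc m} f refl ω σ inv = begin
  run (f zero ++ rest) ω (σ zero)        ≡⟨ run-++ (f zero) rest ω (σ zero) ⟩
  run rest ω (run (f zero) ω (σ zero))   ≡⟨ cong (run rest ω) (inv zero) ⟩
  run rest ω (σ (suc zero))              ≡⟨ run-concat (f ∘ suc) refl ω (σ ∘ suc) (inv ∘ suc) ⟩
  σ (fromℕ (ℕ.suc m))                    ∎
  where
  open ≡-Reasoning
  rest = concat (List.tabulate (f ∘ suc))

-- Reachability in a bunkbed graph

module Levels (G : Digraph) where
  open Digraph G using (src; tgt)
  open Bunkbed G

  at : Bool → V G → V̄
  at false = _⁻
  at true  = _⁺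

  copy : Bool → E G → Fin #Ē
  copy false = lower
  copy true  = upper

  along : ∀ {ω} s e → copy s e ∈ ω → Step ω (at s (src e)) (at s (tgt e))
  along false = along⁻
  along true  = along⁺

  cross : ∀ {ω} s v → vertical v ∈ ω → Step ω (at (not s) v) (at s v)
  cross false = down
  cross true  = up

  module _ (ω : Subset #Ē) (u : V G) where

    -- A local description of reachability: a walk arrives at a vertex horizontally, or starts
    -- there, and then uses its vertical edge at most once.
    Enters Reached : Bool → V G → Set
    Enters s v = at s v ≡ u ⁻ ⊎ ∃ λ e → tgt e ≡ v × copy s e ∈ ω × (u ⁻ ⟶ at s (src e)) ω
    Reached s v = Enters s v ⊎ (vertical v ∈ ω × Enters (not s) v)

    enters⇒⟶ : ∀ s {v} → Enters s v → (u ⁻ ⟶ at s v) ω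
    enters⇒⟶ s (inj₁ eq)                    = subst (λ x → (u ⁻ ⟶ x) ω) (sym eq) ε
    enters⇒⟶ s (inj₂ (e , refl , e∈ω , u⟶)) = u⟶ ◅◅ along s e e∈ω ◅ ε

    reached⇒⟶ : ∀ s {v} → Reached s v → (u ⁻ ⟶ at s v) ω
    reached⇒⟶ s     (inj₁ en)         = enters⇒⟶ s en
    reached⇒⟶ s {v} (inj₂ (v∈ω , en)) = enters⇒⟶ (not s) en ◅◅ cross s v v∈ω ◅ ε

    ReachedAt : V̄ → Set
    ReachedAt (v ⁻) = Reached false v
    ReachedAt (v ⁺) = Reached true v

    reachedAt-step : ∀ {x y} → (u ⁻ ⟶ x) ω → ReachedAt x → Step ω x y → ReachedAt y
    reachedAt-step u⟶ _                 (along⁻ e e∈ω) = inj₁ (inj₂ (e , refl , e∈ω , u⟶))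
    reachedAt-step u⟶ _                 (along⁺ e e∈ω) = inj₁ (inj₂ (e , refl , e∈ω , u⟶))
    reachedAt-step u⟶ (inj₁ en)         (up v v∈ω)     = inj₂ (v∈ω , en)
    reachedAt-step u⟶ (inj₂ (_ , en))   (up v v∈ω)     = inj₁ en
    reachedAt-step u⟶ (inj₁ en)         (down v v∈ω)   = inj₂ (v∈ω , en)
    reachedAt-step u⟶ (inj₂ (_ , en))   (down v v∈ω)   = inj₁ en

    reachedAt-star : ∀ {x y} → (u ⁻ ⟶ x) ω → ReachedAt x → Star (Step ω) x y → ReachedAt y
    reachedAt-star u⟶ r ε          = r
    reachedAt-star u⟶ r (xy ◅ yz) =
      reachedAt-star (u⟶ ◅◅ xy ◅ ε) (reachedAt-step u⟶ r xy) yz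

    ⟶⇔reached : ∀ s {v} → (u ⁻ ⟶ at s v) ω ⇔ Reached s v
    ⟶⇔reached false = mk⇔ (reachedAt-star ε (inj₁ (inj₁ refl))) (reached⇒⟶ false)
    ⟶⇔reached true  = mk⇔ (reachedAt-star ε (inj₁ (inj₁ refl))) (reached⇒⟶ true)

BunkbedCounterexample : Set
BunkbedCounterexample = Σ[ G ∈ Digraph ] Simple G × Acyclic G ×
  (let open Bunkbed G in
  Σ[ u ∈ V G ] Σ[ v ∈ V G ]
  ℙ ½ (u ⁻ ⟶? v ⁻) < ℙ ½ (u ⁻ ⟶? v ⁺))

-- Stated for a variable graph and with arbitrary decision procedures, so that
-- the type checker never unfolds ℙ or Warshall's algorithm on a concrete graph.
-- The opaque definitions below serve the same purpose.

scan-counterexample : (G : Digraph) → let open Bunkbed G in Simple G → Acyclic G →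
  ∀ u v (dec⁻ : Decidable (u ⁻ ⟶ v ⁻)) (dec⁺ : Decidable (u ⁻ ⟶ v ⁺))
  (p : Scan #Ē n) → Unique (map proj₁ p) → ∀ φ ψ s →
  (∀ ω → φ (run p ω s) ≡ 𝟙 (does (dec⁻ ω))) → (∀ ω → ψ (run p ω s) ≡ 𝟙 (does (dec⁺ ω))) →
  read (table p φ) s ℕ.< read (table p ψ) s →
  BunkbedCounterexample
scan-counterexample G simple acyclic u v dec⁻ dec⁺ p unique φ ψ s φ≡ ψ≡ φ<ψ =
  G , simple , acyclic , u , v ,
  ℙ-½-scan-< (u ⁻ ⟶? v ⁻) (u ⁻ ⟶? v ⁺) p unique φ ψ s
    (λ ω → trans (φ≡ ω) (cong 𝟙 (does-≡ (dec⁻ ω) ((u ⁻ ⟶? v ⁻) ω))))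
    (λ ω → trans (ψ≡ ω) (cong 𝟙 (does-≡ (dec⁺ ω) ((u ⁻ ⟶? v ⁺) ω)))) φ<ψ
  where open Bunkbed G

-- The counterexample

module Counterexample where

  pattern path i = suc (suc (suc i))

  G : Digraph
  G = record { #V = 40 ; #E = 42 ; src = src ; tgt = tgt }
    where
    src tgt : Fin 42 → Fin 40
    src 0F       = # 0
    src 1F       = # 10
    src 2F       = # 29
    src (path i) = inject₁ i
    tgt 0F       = # 11
    tgt 1F       = # 30
    tgt 2F       = # 39
    tgt (path i) = suc i

  open Digraph G using (src; tgt)
  open Bunkbed G
  open Levels G

  src<tgt : ∀ e → src e Fin.< tgt e
  src<tgt = from-yes (Fin.all? λ e → src e Fin.<? tgt e)

  simple : Simple G
  simple = record
    { noLoops         = λ e src≡tgt → Fin.<-irrefl src≡tgt (src<tgt e)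
    ; noMultipleEdges = from-yes (Fin.all? λ e → Fin.all? λ f →
        (src e Fin.≟ src f) →-dec ((tgt e Fin.≟ tgt f) →-dec (e Fin.≟ f)))
    }

  acyclic : Acyclic G
  acyclic v v⟶v = Fin.<-irrefl refl (increasing v⟶v)
    where
    increasing : ∀ {x y} → TransClosure (Adjacent G) x y → x Fin.< y
    increasing [ edge e ]     = src<tgt e
    increasing (edge e ∷ y⟶z) = Fin.<-trans (src<tgt e) (increasing y⟶z)

  -- The chord into a vertex is consumed on arrival there, and the preceding
  -- vertex becomes the hub; at the last vertex this leaves the irrelevant 38.

  hub : V G → V G
  hub v =
    if toℕ v ≤ᵇ 10 then # 0 else if toℕ v ≤ᵇ 29 then # 10 else
    if toℕ v ≤ᵇ 38 then # 29 else # 38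

  -- Arrivals are indexed by the preceding vertex.

  chordInto : Fin 39 → Maybe (E G)
  chordInto i =
    if toℕ i ≡ᵇ 10 then just 0F else if toℕ i ≡ᵇ 29 then just 1F else
    if toℕ i ≡ᵇ 38 then just 2F else nothing

  -- All that the correctness of one block needs from the graph: the complete list of edges into the
  -- vertex, and that the hub slots hold the right vertex before and after. It is decidable, hence
  -- checked by evaluation.
  Arrival : Fin 39 → Maybe (E G) → Set
  Arrival i nothing  = (∀ e → tgt e ≡ suc i → e ≡ path i) × hub (inject₁ i) ≡ hub (suc i)
  Arrival i (just c) =
    (∀ e → tgt e ≡ suc i → e ≡ c ⊎ e ≡ path i) ×
    tgt c ≡ suc i × src c ≡ hub (inject₁ i) × inject₁ i ≡ hub (suc i)

  arrival? : ∀ i c → Dec (Arrival i c)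
  arrival? i nothing  =
    Fin.all? (λ e → (tgt e Fin.≟ suc i) →-dec (e Fin.≟ path i)) ×-dec (hub (inject₁ i) Fin.≟ hub (suc i))
  arrival? i (just c) =
    Fin.all? (λ e → (tgt e Fin.≟ suc i) →-dec ((e Fin.≟ c) ⊎-dec (e Fin.≟ path i))) ×-dec
    ((tgt c Fin.≟ suc i) ×-dec ((src c Fin.≟ hub (inject₁ i)) ×-dec (inject₁ i Fin.≟ hub (suc i))))

  arrival : ∀ i → Arrival i (chordInto i)
  arrival = from-yes (Fin.all? λ i → arrival? i (chordInto i))

  -- A state lists the levels − and + of the hub, then those of the current vertex.

  State : Set
  State = Vec Bool 4

  -- Both apply the vertical edge of the new vertex. When a chord arrives, the entries to the new
  -- vertex have been collected in the old hub's slots, and the old current vertex becomes the hub;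
  -- hence the exchange in `swap`.
  stay swap : Bool → State → State
  stay d (h⁻ ∷ h⁺ ∷ c⁻ ∷ c⁺ ∷ []) = h⁻ ∷ h⁺ ∷ (c⁻ ∨ (d ∧ c⁺)) ∷ (c⁺ ∨ (d ∧ c⁻)) ∷ []
  swap d (h⁻ ∷ h⁺ ∷ c⁻ ∷ c⁺ ∷ []) = c⁻ ∷ c⁺ ∷ (h⁻ ∨ (d ∧ h⁺)) ∷ (h⁺ ∨ (d ∧ h⁻)) ∷ []

  thinHub⁻ thinHub⁺ thinCurrent⁻ thinCurrent⁺ join⁻ join⁺ : Bool → State → State
  thinHub⁻     b (h⁻ ∷ s)                     = (b ∧ h⁻) ∷ s
  thinHub⁺     b (h⁻ ∷ h⁺ ∷ s)                = h⁻ ∷ (b ∧ h⁺) ∷ s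
  thinCurrent⁻ b (h⁻ ∷ h⁺ ∷ c⁻ ∷ s)           = h⁻ ∷ h⁺ ∷ (b ∧ c⁻) ∷ s
  thinCurrent⁺ b (h⁻ ∷ h⁺ ∷ c⁻ ∷ c⁺ ∷ [])     = h⁻ ∷ h⁺ ∷ c⁻ ∷ (b ∧ c⁺) ∷ []
  join⁻        b (h⁻ ∷ h⁺ ∷ c⁻ ∷ s)           = (h⁻ ∨ (b ∧ c⁻)) ∷ h⁺ ∷ c⁻ ∷ s
  join⁺        b (h⁻ ∷ h⁺ ∷ c⁻ ∷ c⁺ ∷ [])     = h⁻ ∷ (h⁺ ∨ (b ∧ c⁺)) ∷ c⁻ ∷ c⁺ ∷ []

  arrive : Fin 39 → Maybe (E G) → Scan #Ē 4
  arrive i nothing  =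
    (lower (path i) , thinCurrent⁻) ∷ (upper (path i) , thinCurrent⁺) ∷ (vertical (suc i) , stay) ∷ []
  arrive i (just c) =
    (lower c , thinHub⁻) ∷ (upper c , thinHub⁺) ∷
    (lower (path i) , join⁻) ∷ (upper (path i) , join⁺) ∷ (vertical (suc i) , swap) ∷ []

  start : Bool → State → State
  start d _ = true ∷ d ∷ true ∷ d ∷ []

  arriveAt : Fin 39 → Scan #Ē 4
  arriveAt i = arrive i (chordInto i)

  opaque
    arrivals : Scan #Ē 4
    arrivals = concat (List.tabulate arriveAt)

    arrivals≡ : arrivals ≡ concat (List.tabulate arriveAt)
    arrivals≡ = refl

  scan : Scan #Ē 4
  scan = (vertical zero , start) ∷ arrivals

  empty : State
  empty = false ∷ false ∷ false ∷ false ∷ []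

  current⁻ current⁺ : State → ℕ
  current⁻ (_ ∷ _ ∷ c⁻ ∷ _ ∷ []) = 𝟙 c⁻
  current⁺ (_ ∷ _ ∷ _ ∷ c⁺ ∷ []) = 𝟙 c⁺

  opaque
    unfolding arrivals

    scan-unique : Unique (map proj₁ scan)
    scan-unique = from-yes (DecUnique.unique? (Fin._≟_ {#Ē}) (map proj₁ scan))

    current⁻<current⁺ : read (table scan current⁻) empty ℕ.< read (table scan current⁺) empty
    -- Both sides evaluate to numerals, counting outcomes of the 124 edges, all of which are
    -- scanned.
    current⁻<current⁺ = ℕ.<ᵇ⇒< _ _ _

  opaque
    reachable? : ∀ x → Decidable (zero ⁻ ⟶ x)
    reachable? x = zero ⁻ ⟶? x

  -- Correctness of the scan

  module _ (ω : Subset #Ē) where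

    reach? : ∀ s v → Dec ((zero ⁻ ⟶ at s v) ω)
    reach? s v = reachable? (at s v) ω

    reached : Bool → V G → Bool
    reached s v = does (reach? s v)

    state : V G → State
    state v = reached false (hub v) ∷ reached true (hub v) ∷ reached false v ∷ reached true v ∷ []

    reached-≡ : ∀ {A B : Set} s {v} (a? : Dec A) (b? : Dec B) →
      Enters ω zero s v ⇔ A → Enters ω zero (not s) v ⇔ B →
      does a? ∨ (does (vertical v ∈? ω) ∧ does b?) ≡ reached s v
    reached-≡ s {v} a? b? enters⇔a enters⇔b =
      does-⇔ (mk⇔ from to) (a? ⊎-dec ((vertical v ∈? ω) ×-dec b?)) (reach? s v)
      where
      module A = Equivalence enters⇔a
      module B = Equivalence enters⇔b
      module R = Equivalence (⟶⇔reached ω zero s {v})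
      to : _ → _ ⊎ (_ × _)
      to r with R.to r
      ... | inj₁ en         = inj₁ (A.to en)
      ... | inj₂ (v∈ω , en) = inj₂ (v∈ω , B.to en)
      from : _ ⊎ (_ × _) → _
      from (inj₁ a)         = R.from (inj₁ (A.from a))
      from (inj₂ (v∈ω , b)) = R.from (inj₂ (v∈ω , B.from b))

    reached-zero : state zero ≡ start (does (vertical zero ∈? ω)) empty
    -- `hub zero` is `zero`, so hub and current vertex coincide at the start.
    reached-zero = cong₂ (λ x y → x ∷ y ∷ x ∷ y ∷ []) (sym at⁻) (trans (sym at⁺) (∧-identityʳ _))
      where
      source⁻ : Enters ω zero false zero ⇔ ⊤
      source⁻ = mk⇔ _ (λ _ → inj₁ refl)
      no-entrance : ∀ e → tgt e ≢ zero
      no-entrance 0F       ()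
      no-entrance 1F       ()
      no-entrance 2F       ()
      no-entrance (path i) ()
      source⁺ : Enters ω zero true zero ⇔ ⊥
      source⁺ = mk⇔ (λ { (inj₂ (e , eq , _)) → no-entrance e eq }) λ ()
      at⁻ : true ≡ reached false zero
      at⁻ = reached-≡ false (yes tt) (no λ ()) source⁻ source⁺
      at⁺ : does (vertical zero ∈? ω) ∧ true ≡ reached true zero
      at⁺ = reached-≡ true (no λ ()) (yes tt) source⁺ source⁻

    Through : Bool → E G → V G → Set
    Through s e v = copy s e ∈ ω × (zero ⁻ ⟶ at s v) ω

    through? : ∀ s e v → Dec (Through s e v)
    through? s e v = (copy s e ∈? ω) ×-dec reach? s v

    enters-suc : ∀ s {i} → Enters ω zero s (suc i) → ∃ λ e → tgt e ≡ suc i × Through s e (src e)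
    enters-suc false (inj₂ en) = en
    enters-suc true  (inj₂ en) = en

    plain⇔ : ∀ {i} → Arrival i nothing → ∀ s → Enters ω zero s (suc i) ⇔ Through s (path i) (inject₁ i)
    plain⇔ {i} (only , _) s = mk⇔ to (λ th → inj₂ (path i , refl , th))
      where
      to : _ → _
      to en with enters-suc s en
      ... | e , eq , th = subst (λ e → Through s e (src e)) (only e eq) th

    chord⇔ : ∀ {i c} → Arrival i (just c) → ∀ s →
      Enters ω zero s (suc i) ⇔ (Through s c (hub (inject₁ i)) ⊎ Through s (path i) (inject₁ i))
    chord⇔ {i} {c} (only , tgt-c , src-c , _) s = mk⇔ to from
      where
      to : _ → _ ⊎ _
      to en with enters-suc s en
      ... | e , eq , th with only e eq
      ... | inj₁ refl = inj₁ (subst (Through s c) src-c th)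
      ... | inj₂ refl = inj₂ th
      from : _ ⊎ _ → _
      from (inj₁ th) = inj₂ (c , tgt-c , subst (Through s c) (sym src-c) th)
      from (inj₂ th) = inj₂ (path i , refl , th)

    state-≡ : ∀ {h} v {x y} → h ≡ hub v → x ≡ reached false v → y ≡ reached true v →
      reached false h ∷ reached true h ∷ x ∷ y ∷ [] ≡ state v
    state-≡ v refl refl refl = refl

    arrive-correct : ∀ i c → Arrival i c → run (arrive i c) ω (state (inject₁ i)) ≡ state (suc i)
    -- `does` turns `_⊎-dec_` and `_×-dec_` into `_∨_` and `_∧_` definitionally, so the current
    -- entries after `run` are literally the left sides of `level`.
    arrive-correct i nothing arr@(_ , hub≡) = state-≡ (suc i) hub≡ (level false) (level true)
      where
      level : ∀ s → does (through? s (path i) (inject₁ i)) ∨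
        (does (vertical (suc i) ∈? ω) ∧ does (through? (not s) (path i) (inject₁ i))) ≡ reached s (suc i)
      level s = reached-≡ s (through? s _ _) (through? (not s) _ _) (plain⇔ arr s) (plain⇔ arr (not s))
    arrive-correct i (just c) arr@(_ , _ , _ , hub≡) = state-≡ (suc i) hub≡ (level false) (level true)
      where
      entrance? : ∀ s → Dec (Through s c (hub (inject₁ i)) ⊎ Through s (path i) (inject₁ i))
      entrance? s = through? s _ _ ⊎-dec through? s _ _
      level : ∀ s → does (entrance? s) ∨
        (does (vertical (suc i) ∈? ω) ∧ does (entrance? (not s))) ≡ reached s (suc i)
      level s = reached-≡ s (entrance? s) (entrance? (not s)) (chord⇔ arr s) (chord⇔ arr (not s))

    scan-correct : run scan ω empty ≡ state (fromℕ 39)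
    scan-correct = trans (cong (run arrivals ω) (sym reached-zero))
      (run-concat arriveAt arrivals≡ ω state (λ i → arrive-correct i (chordInto i) (arrival i)))

theorem1p2 : Σ[ G ∈ Digraph ] Simple G × Acyclic G ×
    (let open Bunkbed G in
    Σ[ u ∈ V G ] Σ[ v ∈ V G ]
    ℙ ½ (u ⁻ ⟶? v ⁻) < ℙ ½ (u ⁻ ⟶? v ⁺))
theorem1p2 = scan-counterexample G simple acyclic zero (fromℕ 39)
  (reachable? (fromℕ 39 ⁻)) (reachable? (fromℕ 39 ⁺)) scan scan-unique current⁻ current⁺ empty
  (λ ω → cong current⁻ (scan-correct ω)) (λ ω → cong current⁺ (scan-correct ω)) current⁻<current⁺
  where
  open Counterexample
  open Bunkbed G
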